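{- Let $\mathcal{V}$ be a strongly irregular variety of a plural type (possibly with constants) and let $\mathcal{V}_1,\mathcal{V}_2$ be subvarieties of $\mathcal{V}$. Then the following are equivalent: (i) $(\mathcal{V}_1,\mathcal{V}_2)$ is a splitting pair in $\mathbf{L}(\mathcal{V})$; (ii) $(R(\mathcal{V}_1),R(\mathcal{V}_2))$ is a splitting pair in $\mathbf{L}_R$; (iii) $(\mathcal{V}_1,R(\mathcal{V}_2))$ is a splitting pair in $\mathbf{L}(R(\mathcal{V}))$.
   Context: A type is plural if it contains at least one operation symbol of arity at least $2$. An identity is regular if the same variables occur on both sides. A variety $\mathcal{V}$ is strongly irregular if there is a binary term $f(x,y)$, in which both variables actually occur, such that $\mathcal{V}\models f(x,y)\approx x$. $R(\mathcal{V})$ is the variety (of the same type) defined by all regular identities holding in $\mathcal{V}$. $\mathbf{L}(\mathcal{V})$ is the lattice of subvarieties of $\mathcal{V}$ ordered by inclusion, and $\mathbf{L}_R$ is the sublattice of $\mathbf{L}(R(\mathcal{V}))$ consisting of all regularizations $R(\mathcal{W})$ with $\mathcal{W}\in\mathbf{L}(\mathcal{V})$. A pair $(a,b)$ of elements of a lattice $\mathbf{L}$ is a splitting pair if $a\nleq b$ and for every $c\in L$, $a\le c$ or $c\le b$. -}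

module Defs where

open import Data.Fin.Base using (Fin; zero)
open import Data.Nat.Base using (ℕ; zero; _≤_)
open import Data.Product.Base using (Σ; ∃-syntax; _×_; _,_; proj₁)
open import Data.Sum.Base using (_⊎_)
open import Function.Bundles using (_⇔_; mk⇔; Equivalence)
open import Level using (Level; suc)
open import Relation.Binary.Bundles using (Poset; Setoid)
import Relation.Binary.Construct.On as On
open import Relation.Binary.PropositionalEquality.Core using (_≡_)
open import Relation.Nullary.Negation using (¬_)
open import Relation.Unary using (Pred; _⊆′_)
open import Relation.Unary.Relation.Binary.Subset using (⊆′-poset)

private
  variable
    ℓ : Level

-- Only the order of a lattice enters the notion of a splitting pair.
IsSplittingPair : ∀ {c ℓ₁ ℓ₂} (L : Poset c ℓ₁ ℓ₂) → let open Poset L in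
                  Carrier → Carrier → Set _
IsSplittingPair L a b = ¬ (a ⊑ b) × (∀ c → a ⊑ c ⊎ c ⊑ b)
  where open Poset L renaming (_≤_ to _⊑_)

record Signature ℓ : Set (suc ℓ) where
  field
    Op    : Set ℓ
    arity : Op → ℕ

open Signature public

Plural : Signature ℓ → Set ℓ
Plural S = ∃[ o ] 2 ≤ arity S o

data Term (S : Signature ℓ) (X : Set) : Set ℓ where
  var  : X → Term S X
  node : (o : Op S) → (Fin (arity S o) → Term S X) → Term S X

_OccursIn_ : {S : Signature ℓ} {X : Set} → X → Term S X → Set
x OccursIn var y     = x ≡ y
x OccursIn node o ts = ∃[ i ] x OccursIn ts i

Regular : {S : Signature ℓ} {X : Set} → Term S X → Term S X → Set
Regular s t = ∀ x → x OccursIn s ⇔ x OccursIn t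

-- Algebras live on setoids, so that quotients exist. As usual in universal
-- algebra they are nonempty; homomorphisms play no role here, so choosing a
-- witness adds no structure.
record Algebra (S : Signature ℓ) : Set (suc ℓ) where
  field
    setoid : Setoid ℓ ℓ

  open Setoid setoid public

  field
    point       : Carrier
    interp      : (o : Op S) → (Fin (arity S o) → Carrier) → Carrier
    interp-cong : ∀ o {as bs} → (∀ i → as i ≈ bs i) → interp o as ≈ interp o bs

  eval : {X : Set} → (X → Carrier) → Term S X → Carrier
  eval ρ (var x)     = ρ x
  eval ρ (node o ts) = interp o (λ i → eval ρ (ts i))

infix 4 _⊨_≈_ _⊩_≈_ _⊢_≈_

_⊨_≈_ : {S : Signature ℓ} {X : Set} → Algebra S → Term S X → Term S X → Set ℓ
A ⊨ s ≈ t = ∀ ρ → eval ρ s ∼ eval ρ t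
  where open Algebra A renaming (_≈_ to _∼_)

-- A variety is a class of algebras axiomatised by a set of identities in
-- countably many variables.
record Variety (S : Signature ℓ) : Set (suc (suc ℓ)) where
  field
    Member      : Pred (Algebra S) (suc ℓ)
    Axiom       : Term S ℕ → Term S ℕ → Set ℓ
    axiomatised : ∀ A → Member A ⇔ (∀ s t → Axiom s t → A ⊨ s ≈ t)

open Variety public

_⊩_≈_ : {S : Signature ℓ} {X : Set} → Variety S → Term S X → Term S X → Set (suc ℓ)
V ⊩ s ≈ t = ∀ A → Member V A → A ⊨ s ≈ t

StronglyIrregular : {S : Signature ℓ} → Variety S → Set (suc ℓ)
StronglyIrregular {S = S} V =
  ∃[ f ] (∀ (i : Fin 2) → i OccursIn f) × V ⊩ f ≈ var {S = S} zero

-- Equational logic, with soundness and completeness. It is needed only because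
-- the definition of a regularization quantifies over all algebras of V, and so
-- does not itself give a set of axioms in Set ℓ.

_[_] : {S : Signature ℓ} {X Y : Set} → Term S X → (X → Term S Y) → Term S Y
var x     [ σ ] = σ x
node o ts [ σ ] = node o (λ i → ts i [ σ ])

data _⊢_≈_ {S : Signature ℓ} (E : Term S ℕ → Term S ℕ → Set ℓ) :
           Term S ℕ → Term S ℕ → Set ℓ where
  axiom  : ∀ {s t} → E s t → (σ : ℕ → Term S ℕ) → E ⊢ s [ σ ] ≈ t [ σ ]
  ⊢refl  : ∀ {s} → E ⊢ s ≈ s
  ⊢sym   : ∀ {s t} → E ⊢ s ≈ t → E ⊢ t ≈ s
  ⊢trans : ∀ {s t u} → E ⊢ s ≈ t → E ⊢ t ≈ u → E ⊢ s ≈ u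
  ⊢cong  : ∀ {o ss ts} → (∀ i → E ⊢ ss i ≈ ts i) → E ⊢ node o ss ≈ node o ts

module _ {S : Signature ℓ} where

  eval-[] : (A : Algebra S) → let open Algebra A in
            {X Y : Set} (ρ : Y → Carrier) (σ : X → Term S Y) (t : Term S X) →
            eval ρ (t [ σ ]) ≈ eval (λ x → eval ρ (σ x)) t
  eval-[] A ρ σ (var x)     = Algebra.refl A
  eval-[] A ρ σ (node o ts) = Algebra.interp-cong A o (λ i → eval-[] A ρ σ (ts i))

  sound : (A : Algebra S) {E : Term S ℕ → Term S ℕ → Set ℓ} →
          (∀ s t → E s t → A ⊨ s ≈ t) → ∀ {s t} → E ⊢ s ≈ t → A ⊨ s ≈ t
  sound A A⊨E (axiom {s} {t} e σ) ρ =
    trans (eval-[] A ρ σ s) (trans (A⊨E s t e _) (sym (eval-[] A ρ σ t)))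
    where open Algebra A
  sound A A⊨E ⊢refl        ρ = Algebra.refl A
  sound A A⊨E (⊢sym p)     ρ = Algebra.sym A (sound A A⊨E p ρ)
  sound A A⊨E (⊢trans p q) ρ = Algebra.trans A (sound A A⊨E p ρ) (sound A A⊨E q ρ)
  sound A A⊨E (⊢cong ps)   ρ = Algebra.interp-cong A _ (λ i → sound A A⊨E (ps i) ρ)

  free : (Term S ℕ → Term S ℕ → Set ℓ) → Algebra S
  free E = record
    { setoid = record
      { Carrier       = Term S ℕ
      ; _≈_           = E ⊢_≈_
      ; isEquivalence = record { refl = ⊢refl ; sym = ⊢sym ; trans = ⊢trans }
      }
    ; point       = var zero
    ; interp      = node
    ; interp-cong = λ _ → ⊢cong
    }

  eval-free : ∀ E (σ : ℕ → Term S ℕ) t → E ⊢ Algebra.eval (free E) σ t ≈ t [ σ ]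
  eval-free E σ (var x)     = ⊢refl
  eval-free E σ (node o ts) = ⊢cong (λ i → eval-free E σ (ts i))

  [var] : ∀ E (t : Term S ℕ) → E ⊢ t [ var ] ≈ t
  [var] E (var x)     = ⊢refl
  [var] E (node o ts) = ⊢cong (λ i → [var] E (ts i))

  free-member : (V : Variety S) → Member V (free (Axiom V))
  free-member V = Equivalence.from (axiomatised V (free E)) λ s t e σ →
    ⊢trans (eval-free E σ s) (⊢trans (axiom e σ) (⊢sym (eval-free E σ t)))
    where E = Axiom V

  complete : (V : Variety S) {s t : Term S ℕ} → V ⊩ s ≈ t → Axiom V ⊢ s ≈ t
  complete V {s} {t} p =
    ⊢trans (⊢sym (eval-var s)) (⊢trans (p (free E) (free-member V) var) (eval-var t))
    where
    E = Axiom V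
    eval-var : ∀ u → E ⊢ Algebra.eval (free E) var u ≈ u
    eval-var u = ⊢trans (eval-free E var u) ([var] E u)

  sound-⊩ : (V : Variety S) {s t : Term S ℕ} → Axiom V ⊢ s ≈ t → V ⊩ s ≈ t
  sound-⊩ V p A A∈V = sound A (Equivalence.to (axiomatised V A) A∈V) p

  R : Variety S → Variety S
  R V .Member A      = ∀ (s t : Term S ℕ) → Regular s t → V ⊩ s ≈ t → A ⊨ s ≈ t
  R V .Axiom s t     = Regular s t × Axiom V ⊢ s ≈ t
  R V .axiomatised A = mk⇔
    (λ A∈RV s t (reg , p) → A∈RV s t reg (sound-⊩ V p))
    (λ A⊨RV s t reg V⊩ → A⊨RV s t (reg , complete V V⊩))

  _⊑_ : Variety S → Variety S → Set (suc ℓ)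
  W ⊑ V = Member W ⊆′ Member V

  ⊑-trans : ∀ U V W → U ⊑ V → V ⊑ W → U ⊑ W
  ⊑-trans U V W p q A A∈U = q A (p A A∈U)

  R-extensive : ∀ V → V ⊑ R V
  R-extensive V A A∈V s t reg V⊩ = V⊩ A A∈V

  R-monotone : ∀ W V → W ⊑ V → R W ⊑ R V
  R-monotone W V p A A∈RW s t reg V⊩ = A∈RW s t reg (λ B B∈W → V⊩ B (p B B∈W))

  Subvariety : Variety S → Set (suc (suc ℓ))
  Subvariety V = Σ (Variety S) (_⊑ V)

  -- Equality in this poset is mutual inclusion of classes, so the choice of
  -- axioms is irrelevant.
  L : Variety S → Poset _ _ _
  L V = On.poset {B = Subvariety V} (⊆′-poset (Algebra S) (suc ℓ)) (λ W → Member (proj₁ W))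

  R-sub : ∀ V → Subvariety V → Subvariety (R V)
  R-sub V (W , W⊑V) = R W , R-monotone W V W⊑V

  include : ∀ V → Subvariety V → Subvariety (R V)
  include V (W , W⊑V) = W , ⊑-trans W V (R V) W⊑V (R-extensive V)

  IsRegularization : ∀ V → Subvariety (R V) → Set _
  IsRegularization V U = ∃[ W ] U ≈ R-sub V W
    where open Poset (L (R V))

  L-R : Variety S → Poset _ _ _
  L-R V = On.poset {B = Σ (Subvariety (R V)) (IsRegularization V)} (L (R V)) proj₁

  regularization : ∀ V → Subvariety V → Poset.Carrier (L-R V)
  regularization V W = R-sub V W , W , Poset.Eq.refl (L (R V)) {R-sub V W}

{-# OPTIONS --safe #-}

-- Write x ∙ y for the binary term f(x , y), so that V ⊨ x ∙ y ≈ x. Every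
-- identity s ≈ t of W ⊑ V has the regular form s ∙ t ≈ t ∙ s, hence R W meets V
-- in W and R is an order isomorphism from L V onto L-R V. For (iii), if U ⊑ R V
-- then U ⊑ R (U ⊓ V): given A in U and e in A, the elements a with e ∙ a ≈ e
-- form a subalgebra (as in a Płonka sum), and identifying a with b when
-- a ∙ e ≈ b ∙ e turns it into an algebra of U ⊓ V. Taking for e the value of s,
-- a regular identity s ≈ t of U ⊓ V is thereby pulled back to A.
module Submission where

open import Defs
open import Data.Fin.Base using (Fin; zero; suc; toℕ)
open import Data.Fin.Properties using (any?)
open import Data.Nat.Base using (ℕ; zero; suc)
open import Data.Nat.Properties using (_≟_)
open import Data.Product.Base using (Σ-syntax; ∃-syntax; _×_; _,_; proj₁; proj₂)
open import Data.Sum.Base using (_⊎_; inj₁; inj₂; [_,_]; map)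
open import Function.Base using (_∘_; id)
open import Function.Bundles using (_⇔_; mk⇔; Equivalence)
open import Level using (Level)
open import Relation.Binary.PropositionalEquality.Core using (_≡_; refl; cong)
open import Relation.Nullary.Decidable.Core using (Dec; yes; no)
open import Relation.Nullary.Negation using (contradiction)
import Relation.Binary.Reasoning.Setoid as SetoidReasoning

private
  variable
    ℓ : Level

-- Finite variable sets inside ℕ.

clamp : ∀ n → ℕ → Fin (suc n)
clamp n       zero    = zero
clamp zero    (suc m) = zero
clamp (suc n) (suc m) = suc (clamp n m)

-- Makes `clamp` a retraction of `toℕ`, along which a valuation of n + 1 variables extends to ℕ;
-- larger indices go to the last element.
clamp-toℕ : ∀ n (i : Fin (suc n)) → clamp n (toℕ i) ≡ i
clamp-toℕ n       zero    = refl
clamp-toℕ (suc n) (suc i) = cong suc (clamp-toℕ n i)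

pair : ∀ {a} {A : Set a} → A → A → Fin 2 → A
pair x y zero    = x
pair x y (suc _) = y

module _ {S : Signature ℓ} where

  -- Occurrence of variables, substitution and evaluation.

  occursIn-[]⁺ : {X Y : Set} (t : Term S X) (σ : X → Term S Y) {x : X} {y : Y} →
                 x OccursIn t → y OccursIn σ x → y OccursIn (t [ σ ])
  occursIn-[]⁺ (var x)     σ refl    q = q
  occursIn-[]⁺ (node o ts) σ (i , p) q = i , occursIn-[]⁺ (ts i) σ p q

  occursIn-[]⁻ : {X Y : Set} (t : Term S X) (σ : X → Term S Y) {y : Y} →
                 y OccursIn (t [ σ ]) → ∃[ x ] x OccursIn t × y OccursIn σ x
  occursIn-[]⁻ (var x)     σ q       = x , refl , q
  occursIn-[]⁻ (node o ts) σ (i , q) with occursIn-[]⁻ (ts i) σ q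
  ... | x , p , r = x , (i , p) , r

  -- Decidability lets `restrict` change a valuation off the variables of a term constructively.
  occursIn? : (x : ℕ) (t : Term S ℕ) → Dec (x OccursIn t)
  occursIn? x (var y)     = x ≟ y
  occursIn? x (node o ts) = any? (λ i → occursIn? x (ts i))

  regular-[] : {X Y : Set} (s t : Term S X) (σ : X → Term S Y) →
               Regular s t → Regular (s [ σ ]) (t [ σ ])
  regular-[] s t σ reg y = mk⇔ (transport s t (Equivalence.to ∘ reg))
                               (transport t s (Equivalence.from ∘ reg))
    where
    transport : ∀ u v → (∀ x → x OccursIn u → x OccursIn v) →
                y OccursIn (u [ σ ]) → y OccursIn (v [ σ ])
    transport u v h q with occursIn-[]⁻ u σ q
    ... | x , p , r = occursIn-[]⁺ v σ (h x p) r

  module _ (A : Algebra S) where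
    open Algebra A renaming (refl to ≈-refl)

    eval-cong-occurring : {X : Set} {ρ ρ′ : X → Carrier} (t : Term S X) →
                          (∀ x → x OccursIn t → ρ x ≈ ρ′ x) → eval ρ t ≈ eval ρ′ t
    eval-cong-occurring (var x)     h = h x refl
    eval-cong-occurring (node o ts) h =
      interp-cong o (λ i → eval-cong-occurring (ts i) (λ x p → h x (i , p)))

    eval-cong : {X : Set} {ρ ρ′ : X → Carrier} (t : Term S X) →
                (∀ x → ρ x ≈ ρ′ x) → eval ρ t ≈ eval ρ′ t
    eval-cong t h = eval-cong-occurring t (λ x _ → h x)

  -- Meets of varieties and transfer of regular identities.

  _⊓_ : Variety S → Variety S → Variety S
  (U ⊓ V) .Member A      = Member U A × Member V A
  (U ⊓ V) .Axiom s t     = Axiom U s t ⊎ Axiom V s t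
  (U ⊓ V) .axiomatised A = mk⇔
    (λ (A∈U , A∈V) s t → [ Equivalence.to (axiomatised U A) A∈U s t
                         , Equivalence.to (axiomatised V A) A∈V s t ])
    (λ A⊨ → Equivalence.from (axiomatised U A) (λ s t → A⊨ s t ∘ inj₁)
          , Equivalence.from (axiomatised V A) (λ s t → A⊨ s t ∘ inj₂))

  axiom⇒⊩ : (W : Variety S) {s t : Term S ℕ} → Axiom W s t → W ⊩ s ≈ t
  axiom⇒⊩ W ax A A∈W = Equivalence.to (axiomatised W A) A∈W _ _ ax

  -- R V only refers to identities over ℕ; this passes to n + 1 variables.
  R⊨ : (V : Variety S) (A : Algebra S) → Member (R V) A →
       ∀ {n} (s t : Term S (Fin (suc n))) → Regular s t → V ⊩ s ≈ t → A ⊨ s ≈ t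
  R⊨ V A A∈RV {n} s t reg V⊩ ρ = begin
    eval ρ s                      ≈⟨ encode s ⟨
    eval (ρ ∘ clamp n) (s [ σ ])  ≈⟨ A∈RV (s [ σ ]) (t [ σ ]) (regular-[] s t σ reg) V⊩σ (ρ ∘ clamp n) ⟩
    eval (ρ ∘ clamp n) (t [ σ ])  ≈⟨ encode t ⟩
    eval ρ t                      ∎
    where
    open Algebra A hiding (refl)
    open SetoidReasoning setoid
    σ : Fin (suc n) → Term S ℕ
    σ i = var (toℕ i)
    V⊩σ : V ⊩ s [ σ ] ≈ t [ σ ]
    V⊩σ B B∈V ρ′ = Algebra.trans B (eval-[] B ρ′ σ s)
      (Algebra.trans B (V⊩ B B∈V _) (Algebra.sym B (eval-[] B ρ′ σ t)))
    encode : ∀ u → eval (ρ ∘ clamp n) (u [ σ ]) ≈ eval ρ u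
    encode u = trans (eval-[] A (ρ ∘ clamp n) σ u)
      (eval-cong A u (λ i → reflexive (cong ρ (clamp-toℕ n i))))

  -- The binary term and the regular identities it yields.

  module StrongIrregularity (V : Variety S) (f : Term S (Fin 2))
    (f-occurs : ∀ i → i OccursIn f) (f≈x : V ⊩ f ≈ var {S = S} zero) where

    infixl 8 _∙_

    _∙_ : {X : Set} → Term S X → Term S X → Term S X
    s ∙ t = f [ pair s t ]

    module _ {X : Set} (s t : Term S X) {x : X} where

      occursIn-∙⁺ : x OccursIn s ⊎ x OccursIn t → x OccursIn (s ∙ t)
      occursIn-∙⁺ = [ occursIn-[]⁺ f (pair s t) (f-occurs zero)
                    , occursIn-[]⁺ f (pair s t) (f-occurs (suc zero)) ]

      occursIn-∙⁻ : x OccursIn (s ∙ t) → x OccursIn s ⊎ x OccursIn t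
      occursIn-∙⁻ p with occursIn-[]⁻ f (pair s t) p
      ... | zero  , _ , q = inj₁ q
      ... | suc _ , _ , q = inj₂ q

    ∙-projˡ : {X : Set} (s t : Term S X) → V ⊩ s ∙ t ≈ s
    ∙-projˡ s t A A∈V ρ = Algebra.trans A (eval-[] A ρ (pair s t) f) (f≈x A A∈V _)

    ∙-swap-regular : {X : Set} (s t : Term S X) → Regular (s ∙ t) (t ∙ s)
    ∙-swap-regular s t x = mk⇔ (swap s t) (swap t s)
      where
      swap : ∀ u v → x OccursIn (u ∙ v) → x OccursIn (v ∙ u)
      swap u v = occursIn-∙⁺ v u ∘ [ inj₂ , inj₁ ] ∘ occursIn-∙⁻ u v

    ∙-absorb-regular : {X : Set} (s t : Term S X) →
                       (∀ x → x OccursIn t → x OccursIn s) → Regular (s ∙ t) s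
    ∙-absorb-regular s t t⊆s x =
      mk⇔ ([ id , t⊆s x ] ∘ occursIn-∙⁻ s t) (occursIn-∙⁺ s t ∘ inj₁)

    ∙-swap : ∀ W → W ⊑ V → {X : Set} (s t : Term S X) → W ⊩ s ≈ t → W ⊩ s ∙ t ≈ t ∙ s
    ∙-swap W W⊑V s t W⊩ A A∈W ρ = trans (∙-projˡ s t A (W⊑V A A∈W) ρ)
      (trans (W⊩ A A∈W ρ) (sym (∙-projˡ t s A (W⊑V A A∈W) ρ)))
      where open Algebra A

    -- An axiom s ≈ t of `W` survives in `R W` as s ∙ t ≈ t ∙ s, whose sides collapse to s and t
    -- inside `V`.
    R-meet : ∀ W → W ⊑ V → (R W ⊓ V) ⊑ W
    R-meet W W⊑V A (A∈RW , A∈V) =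
      Equivalence.from (axiomatised W A) λ s t ax ρ →
        trans (sym (∙-projˡ s t A A∈V ρ))
          (trans (A∈RW (s ∙ t) (t ∙ s) (∙-swap-regular s t)
                       (∙-swap W W⊑V s t (axiom⇒⊩ W ax)) ρ)
            (∙-projˡ t s A A∈V ρ))
      where open Algebra A

    R-reflects : ∀ W₁ W₂ → W₁ ⊑ V → W₂ ⊑ V → W₁ ⊑ R W₂ → W₁ ⊑ W₂
    R-reflects W₁ W₂ W₁⊑V W₂⊑V W₁⊑RW₂ A A∈W₁ =
      R-meet W₂ W₂⊑V A (W₁⊑RW₂ A A∈W₁ , W₁⊑V A A∈W₁)

    -- Fibres of an algebra of `R V`.

    module Fibre (A : Algebra S) (A∈RV : Member (R V) A) where
      open Algebra A renaming (refl to ≈-refl)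
      open SetoidReasoning setoid

      infixl 8 _·_

      _·_ : Carrier → Carrier → Carrier
      a · b = eval (pair a b) f

      ·-cong : ∀ {a a′ b b′} → a ≈ a′ → b ≈ b′ → a · b ≈ a′ · b′
      ·-cong p q = eval-cong A f λ { zero → p ; (suc _) → q }

      eval-∙ : {X : Set} (ρ : X → Carrier) (s t : Term S X) →
               eval ρ (s ∙ t) ≈ eval ρ s · eval ρ t
      eval-∙ ρ s t = trans (eval-[] A ρ (pair s t) f)
        (eval-cong A f λ { zero → ≈-refl ; (suc _) → ≈-refl })

      ·-absorb : {n : ℕ} (ρ : Fin (suc n) → Carrier) (s t : Term S (Fin (suc n))) →
                 (∀ x → x OccursIn t → x OccursIn s) → eval ρ s · eval ρ t ≈ eval ρ s
      ·-absorb ρ s t t⊆s = trans (sym (eval-∙ ρ s t))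
        (R⊨ V A A∈RV (s ∙ t) s (∙-absorb-regular s t t⊆s) (∙-projˡ s t) ρ)

      ·-idem : ∀ a → a · a ≈ a
      ·-idem a = ·-absorb {0} (λ _ → a) (var zero) (var zero) (λ _ → id)

      -- Both sides contain all three variables and reduce to the first one in `V`. The order c · b
      -- suits the fibre over c, where c · b ≈ c removes b.
      ·-assoc-swap : ∀ a b c → a · b · c ≈ a · (c · b)
      ·-assoc-swap a b c = begin
        a · b · c               ≈⟨ ·-cong (eval-∙ ρ x y) ≈-refl ⟨
        eval ρ (x ∙ y) · c      ≈⟨ eval-∙ ρ (x ∙ y) z ⟨
        eval ρ (x ∙ y ∙ z)      ≈⟨ R⊨ V A A∈RV (x ∙ y ∙ z) (x ∙ (z ∙ y)) regular V⊩ ρ ⟩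
        eval ρ (x ∙ (z ∙ y))    ≈⟨ eval-∙ ρ x (z ∙ y) ⟩
        a · eval ρ (z ∙ y)      ≈⟨ ·-cong ≈-refl (eval-∙ ρ z y) ⟩
        a · (c · b)             ∎
        where
        x y z : Term S (Fin 3)
        x = var zero
        y = var (suc zero)
        z = var (suc (suc zero))
        ρ : Fin 3 → Carrier
        ρ zero          = a
        ρ (suc zero)    = b
        ρ (suc (suc _)) = c
        regular : Regular (x ∙ y ∙ z) (x ∙ (z ∙ y))
        regular v = mk⇔
          (occursIn-∙⁺ x (z ∙ y)
            ∘ [ map id (occursIn-∙⁺ z y ∘ inj₂) ∘ occursIn-∙⁻ x y
              , inj₂ ∘ occursIn-∙⁺ z y ∘ inj₁ ]
            ∘ occursIn-∙⁻ (x ∙ y) z)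
          (occursIn-∙⁺ (x ∙ y) z
            ∘ [ inj₁ ∘ occursIn-∙⁺ x y ∘ inj₁
              , [ inj₂ , inj₁ ∘ occursIn-∙⁺ x y ∘ inj₂ ] ∘ occursIn-∙⁻ z y ]
            ∘ occursIn-∙⁻ x (z ∙ y))
        V⊩ : V ⊩ x ∙ y ∙ z ≈ x ∙ (z ∙ y)
        V⊩ B B∈V τ = Algebra.trans B (∙-projˡ (x ∙ y) z B B∈V τ)
          (Algebra.trans B (∙-projˡ x y B B∈V τ)
            (Algebra.sym B (∙-projˡ x (z ∙ y) B B∈V τ)))

      module _ (o : Op S) (a : Carrier) (as : Fin (arity S o) → Carrier) where

        private
          X : Set
          X = Fin (suc (arity S o))
          ρ : X → Carrier
          ρ zero    = a
          ρ (suc i) = as i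
          y : Term S X
          y = var zero
          x : Fin (arity S o) → Term S X
          x i = var (suc i)

        -- In `V` both sides reduce to a. The outer a keeps the identity regular even if `o` is a
        -- constant.
        ·-interp : a · interp o as ≈ a · interp o (λ i → a · as i)
        ·-interp = begin
          a · interp o as                      ≈⟨ eval-∙ ρ y l ⟨
          eval ρ (y ∙ l)                       ≈⟨ R⊨ V A A∈RV (y ∙ l) (y ∙ r) regular V⊩ ρ ⟩
          eval ρ (y ∙ r)                       ≈⟨ eval-∙ ρ y r ⟩
          a · interp o (λ i → eval ρ (y ∙ x i))  ≈⟨ ·-cong ≈-refl (interp-cong o (λ i → eval-∙ ρ y (x i))) ⟩
          a · interp o (λ i → a · as i)        ∎
          where
          l r : Term S X
          l = node o x
          r = node o (λ i → y ∙ x i)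
          regular : Regular (y ∙ l) (y ∙ r)
          regular v = mk⇔
            (occursIn-∙⁺ y r
              ∘ map id (λ (i , p) → i , occursIn-∙⁺ y (x i) (inj₂ p))
              ∘ occursIn-∙⁻ y l)
            (occursIn-∙⁺ y l
              ∘ [ inj₁ , (λ (i , p) → map id (i ,_) (occursIn-∙⁻ y (x i) p)) ]
              ∘ occursIn-∙⁻ y r)
          V⊩ : V ⊩ y ∙ l ≈ y ∙ r
          V⊩ B B∈V τ = Algebra.trans B (∙-projˡ y l B B∈V τ)
            (Algebra.sym B (∙-projˡ y r B B∈V τ))

        interp-· : interp o as · a ≈ interp o (λ i → as i · a) · a
        interp-· = begin
          interp o as · a                        ≈⟨ eval-∙ ρ l y ⟨
          eval ρ (l ∙ y)                         ≈⟨ R⊨ V A A∈RV (l ∙ y) (r ∙ y) regular V⊩ ρ ⟩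
          eval ρ (r ∙ y)                         ≈⟨ eval-∙ ρ r y ⟩
          interp o (λ i → eval ρ (x i ∙ y)) · a  ≈⟨ ·-cong (interp-cong o (λ i → eval-∙ ρ (x i) y)) ≈-refl ⟩
          interp o (λ i → as i · a) · a          ∎
          where
          l r : Term S X
          l = node o x
          r = node o (λ i → x i ∙ y)
          regular : Regular (l ∙ y) (r ∙ y)
          regular v = mk⇔
            (occursIn-∙⁺ r y
              ∘ map (λ (i , p) → i , occursIn-∙⁺ (x i) y (inj₁ p)) id
              ∘ occursIn-∙⁻ l y)
            (occursIn-∙⁺ l y
              ∘ [ (λ (i , p) → map (i ,_) id (occursIn-∙⁻ (x i) y p)) , inj₂ ]
              ∘ occursIn-∙⁻ r y)
          V⊩ : V ⊩ l ∙ y ≈ r ∙ y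
          V⊩ B B∈V τ = Algebra.trans B (∙-projˡ l y B B∈V τ)
            (Algebra.trans B
              (Algebra.interp-cong B o (λ i → Algebra.sym B (∙-projˡ (x i) y B B∈V τ)))
              (Algebra.sym B (∙-projˡ r y B B∈V τ)))

      ·-interp-closed : ∀ o e as → (∀ i → e · as i ≈ e) → e · interp o as ≈ e
      ·-interp-closed o e as h = begin
        e · interp o as                ≈⟨ ·-interp o e as ⟩
        e · interp o (λ i → e · as i)  ≈⟨ ·-cong ≈-refl (interp-cong o h) ⟩
        -- Here `{0}` means a single variable, and the right term contains at most that one, none if
        -- `o` is a constant.
        e · interp o (λ _ → e)         ≈⟨ ·-absorb {0} (λ _ → e) (var zero)
                                            (node o (λ _ → var zero)) (λ _ → proj₂) ⟩
        e                              ∎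

      -- By `interp-·` the result depends only on the products `as i · e`, so the kernel of a ↦ a ·
      -- e is a congruence.
      interp-·-cong : ∀ o e {as bs} → (∀ i → as i · e ≈ bs i · e) →
                      interp o as · e ≈ interp o bs · e
      interp-·-cong o e {as} {bs} h = begin
        interp o as · e                ≈⟨ interp-· o e as ⟩
        interp o (λ i → as i · e) · e  ≈⟨ ·-cong (interp-cong o h) ≈-refl ⟩
        interp o (λ i → bs i · e) · e  ≈⟨ interp-· o e bs ⟨
        interp o bs · e                ∎

      -- The equality a · e ≈ b · e, rather than a restriction to the elements
      -- a ≈ a · e, keeps the operations of A, constants included.
      fibre : Carrier → Algebra S
      fibre e = record
        { setoid = record
          { Carrier       = Σ[ a ∈ Carrier ] e · a ≈ e
          ; _≈_           = λ a b → proj₁ a · e ≈ proj₁ b · e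
          ; isEquivalence = record { refl = ≈-refl ; sym = sym ; trans = trans }
          }
        ; point       = e , ·-idem e
        ; interp      = λ o as → interp o (proj₁ ∘ as) , ·-interp-closed o e _ (proj₂ ∘ as)
        ; interp-cong = λ o → interp-·-cong o e
        }

      module _ (e : Carrier) where
        private module B = Algebra (fibre e)

        eval-fibre : {X : Set} (ρ : X → B.Carrier) (t : Term S X) →
                     proj₁ (B.eval ρ t) ≈ eval (proj₁ ∘ ρ) t
        eval-fibre ρ (var x)     = ≈-refl
        eval-fibre ρ (node o ts) = interp-cong o (λ i → eval-fibre ρ (ts i))

        fibre-⊨ : {X : Set} (s t : Term S X) → A ⊨ s ≈ t → fibre e ⊨ s ≈ t
        fibre-⊨ s t A⊨ ρ =
          ·-cong (trans (eval-fibre ρ s) (trans (A⊨ _) (sym (eval-fibre ρ t)))) ≈-refl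

        fibre-∈ : ∀ U → Member U A → Member U (fibre e)
        fibre-∈ U A∈U = Equivalence.from (axiomatised U (fibre e)) λ s t ax →
          fibre-⊨ s t (Equivalence.to (axiomatised U A) A∈U s t ax)

        -- The value b of t satisfies e · b ≈ e, so `·-assoc-swap` removes it: in the fibre ∙ is the
        -- left projection.
        fibre-∙ : ∀ ρ (s t : Term S ℕ) →
                  eval (proj₁ ∘ ρ) (s ∙ t) · e ≈ proj₁ (B.eval ρ s) · e
        fibre-∙ ρ s t = begin
          eval (proj₁ ∘ ρ) (s ∙ t) · e                      ≈⟨ ·-cong (eval-∙ (proj₁ ∘ ρ) s t) ≈-refl ⟩
          eval (proj₁ ∘ ρ) s · eval (proj₁ ∘ ρ) t · e       ≈⟨ ·-cong (·-cong (eval-fibre ρ s) (eval-fibre ρ t)) ≈-refl ⟨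
          proj₁ (B.eval ρ s) · proj₁ (B.eval ρ t) · e       ≈⟨ ·-assoc-swap _ _ e ⟩
          proj₁ (B.eval ρ s) · (e · proj₁ (B.eval ρ t))     ≈⟨ ·-cong ≈-refl (proj₂ (B.eval ρ t)) ⟩
          proj₁ (B.eval ρ s) · e                            ∎

        -- Axioms of `V` may be irregular, so only their form s ∙ t ≈ t ∙ s is used in `A`;
        -- `fibre-∙` then strips the second factors.
        fibre-∈V : Member V (fibre e)
        fibre-∈V = Equivalence.from (axiomatised V (fibre e)) λ s t ax ρ → begin
          proj₁ (B.eval ρ s) · e        ≈⟨ fibre-∙ ρ s t ⟨
          eval (proj₁ ∘ ρ) (s ∙ t) · e  ≈⟨ ·-cong (A∈RV (s ∙ t) (t ∙ s) (∙-swap-regular s t)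
                                             (∙-swap V (λ _ → id) s t (axiom⇒⊩ V ax)) (proj₁ ∘ ρ)) ≈-refl ⟩
          eval (proj₁ ∘ ρ) (t ∙ s) · e  ≈⟨ fibre-∙ ρ t s ⟩
          proj₁ (B.eval ρ t) · e        ∎

      -- Pulling regular identities back from a fibre.

      eval-absorb : (ρ : ℕ → Carrier) (s t : Term S ℕ) →
                    (∀ x → x OccursIn t → x OccursIn s) → eval ρ s · eval ρ t ≈ eval ρ s
      eval-absorb ρ s t t⊆s = trans (sym (eval-∙ ρ s t))
        (A∈RV (s ∙ t) s (∙-absorb-regular s t t⊆s) (∙-projˡ s t) ρ)

      module _ (ρ : ℕ → Carrier) (s : Term S ℕ) where
        private
          e : Carrier
          e = eval ρ s
          module B = Algebra (fibre e)

        restrict : ℕ → B.Carrier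
        restrict x with occursIn? x s
        ... | yes x∈s = ρ x , eval-absorb ρ s (var x) (λ { _ refl → x∈s })
        -- Any element of the fibre would serve as default, since only variables of `s` are
        -- evaluated later.
        ... | no  _   = e , ·-idem e

        restrict-occurring : ∀ x → x OccursIn s → proj₁ (restrict x) ≈ ρ x
        restrict-occurring x x∈s with occursIn? x s
        ... | yes _   = ≈-refl
        ... | no  x∉s = contradiction x∈s x∉s

        -- The factor `e` is harmless: it is the value of `s`, which has the same variables as `t`,
        -- so `eval ρ t` absorbs it.
        eval-restrict : (t : Term S ℕ) → Regular s t → proj₁ (B.eval restrict t) · e ≈ eval ρ t
        eval-restrict t reg = begin
          proj₁ (B.eval restrict t) · e    ≈⟨ ·-cong (eval-fibre e restrict t) ≈-refl ⟩
          eval (proj₁ ∘ restrict) t · e    ≈⟨ ·-cong (eval-cong-occurring A t λ x x∈t →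
                                                restrict-occurring x (Equivalence.from (reg x) x∈t)) ≈-refl ⟩
          eval ρ t · e                     ≈⟨ eval-absorb ρ t s (Equivalence.to ∘ reg) ⟩
          eval ρ t                         ∎

    R-⊓ : ∀ U → U ⊑ R V → U ⊑ R (U ⊓ V)
    R-⊓ U U⊑RV A A∈U s t reg U⊓V⊩ ρ = begin
      eval ρ s                                ≈⟨ eval-restrict ρ s s (λ _ → mk⇔ id id) ⟨
      -- Equality in the fibre is by definition equality in `A` after right multiplication by `e`.
      proj₁ (B.eval (restrict ρ s) s) · e     ≈⟨ U⊓V⊩ (fibre e) (fibre-∈ e U A∈U , fibre-∈V e) (restrict ρ s) ⟩
      proj₁ (B.eval (restrict ρ s) t) · e     ≈⟨ eval-restrict ρ s t reg ⟩
      eval ρ t                                ∎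
      where
      open Algebra A hiding (refl)
      open SetoidReasoning setoid
      open Fibre A (U⊑RV A A∈U)
      e : Carrier
      e = eval ρ s
      module B = Algebra (fibre e)

-- Transfer of splitting pairs between the three lattices.

lemma4 : ∀ {ℓ} (S : Signature ℓ) → Plural S → (V : Variety S) → StronglyIrregular V →
    (V₁ V₂ : Subvariety V) →
    (IsSplittingPair (L V) V₁ V₂
    ⇔ IsSplittingPair (L-R V) (regularization V V₁) (regularization V V₂))
    × (IsSplittingPair (L-R V) (regularization V V₁) (regularization V V₂)
    ⇔ IsSplittingPair (L (R V)) (include V V₁) (R-sub V V₂))
lemma4 S _ V (f , f-occurs , f≈x) (V₁ , V₁⊑V) (V₂ , V₂⊑V) =
  mk⇔ i⇒ii ii⇒i , mk⇔ ii⇒iii iii⇒ii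
  where
  open StrongIrregularity V f f-occurs f≈x

  I   = IsSplittingPair (L V) (V₁ , V₁⊑V) (V₂ , V₂⊑V)
  II  = IsSplittingPair (L-R V) (regularization V (V₁ , V₁⊑V)) (regularization V (V₂ , V₂⊑V))
  III = IsSplittingPair (L (R V)) (include V (V₁ , V₁⊑V)) (R-sub V (V₂ , V₂⊑V))

  ⊑R⇒R⊑R : ∀ W → W ⊑ V → V₁ ⊑ R W → R V₁ ⊑ R W
  ⊑R⇒R⊑R W W⊑V = R-monotone V₁ W ∘ R-reflects V₁ W V₁⊑V W⊑V

  R⊑R⇒⊑ : ∀ W₁ W₂ → W₁ ⊑ V → W₂ ⊑ V → R W₁ ⊑ R W₂ → W₁ ⊑ W₂
  R⊑R⇒⊑ W₁ W₂ W₁⊑V W₂⊑V p =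
    R-reflects W₁ W₂ W₁⊑V W₂⊑V (⊑-trans W₁ (R W₁) (R W₂) (R-extensive W₁) p)

  i⇒ii : I → II
  i⇒ii (V₁⋢V₂ , split) =
    V₁⋢V₂ ∘ R⊑R⇒⊑ V₁ V₂ V₁⊑V V₂⊑V ,
    -- An element of `L-R V` carries some `W` below `V` with `U` equal to `R W`, so it is split
    -- according to `W`.
    λ { ((U , _) , (W , W⊑V) , U⊑RW , RW⊑U) → map
      (λ V₁⊑W → ⊑-trans (R V₁) (R W) U (R-monotone V₁ W V₁⊑W) RW⊑U)
      (λ W⊑V₂ → ⊑-trans U (R W) (R V₂) U⊑RW (R-monotone W V₂ W⊑V₂))
      (split (W , W⊑V)) }

  ii⇒i : II → I
  ii⇒i (RV₁⋢RV₂ , split) =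
    RV₁⋢RV₂ ∘ R-monotone V₁ V₂ ,
    λ { (W , W⊑V) → map (R⊑R⇒⊑ V₁ W V₁⊑V W⊑V) (R⊑R⇒⊑ W V₂ W⊑V V₂⊑V)
      (split (regularization V (W , W⊑V))) }

  ii⇒iii : II → III
  ii⇒iii (RV₁⋢RV₂ , split) =
    RV₁⋢RV₂ ∘ ⊑R⇒R⊑R V₂ V₂⊑V ,
    -- `U` need not be a regularization, so the splitting in `L V` is applied to its trace `U ⊓ V`;
    -- `R-⊓` carries the second case back to `U`.
    λ { (U , U⊑RV) → map
      (λ V₁⊑U⊓V A A∈V₁ → proj₁ (V₁⊑U⊓V A A∈V₁))
      (λ U⊓V⊑V₂ → ⊑-trans U (R (U ⊓ V)) (R V₂) (R-⊓ U U⊑RV) (R-monotone (U ⊓ V) V₂ U⊓V⊑V₂))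
      (proj₂ (ii⇒i (RV₁⋢RV₂ , split)) (U ⊓ V , λ _ → proj₂)) }

  iii⇒ii : III → II
  iii⇒ii (V₁⋢RV₂ , split) =
    V₁⋢RV₂ ∘ ⊑-trans V₁ (R V₁) (R V₂) (R-extensive V₁) ,
    λ { ((U , U⊑RV) , (W , W⊑V) , U⊑RW , RW⊑U) → map
      -- As `U` equals `R W`, containing `V₁` already forces it to contain `R V₁`.
      (λ V₁⊑U → ⊑-trans (R V₁) (R W) U (⊑R⇒R⊑R W W⊑V (⊑-trans V₁ U (R W) V₁⊑U U⊑RW)) RW⊑U)
      id
      (split (U , U⊑RV)) }
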